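{- Let $\mathcal{T}$ be a stacked component (the graph specified in the context) and suppose the new edge $\mathcal{E}$, which joins two distinct floor vertices, has both of its endpoints in $\mathcal{T}$. Let $\mathcal{T}+\mathcal{E}$ be the graph obtained from $\mathcal{T}$ by adding the edge $\mathcal{E}$. Then $\mathrm{diam}(\mathcal{T}+\mathcal{E})=\mathrm{diam}(\mathcal{T})$.
   Context: Let $p$ be a prime with $p\equiv 71$ or $119\pmod{120}$, let $\ell=2$, and let $\mathrm{ord}(\ell)$ be the order, in the ideal class group of $\mathbb{Q}(\sqrt{ -p})$, of a prime ideal above $2$; it is an odd integer $\ge 3$. A stacked component $\mathcal{T}$ (a component of the supersingular $2$-isogeny graph over $\mathbb{F}_p$ after identifying curves up to $\overline{\mathbb{F}_p}$-isomorphism, regarded as a simple undirected graph) is, writing $L=\mathrm{ord}(\ell)$, labelled so that $V(\mathcal{T})=\{0,1,\dots,2L-1\}$ and $$E(\mathcal{T})=\{\{2i,2i+1\}:0\le i\le L-1\}\cup\{\{2i+1,2i+3\}:0\le i\le L-2\}\cup\{\{2L-1,1\}\}.$$ The floor vertices of $\mathcal{T}$ are the even vertices. The new edge $\mathcal{E}$ is the single edge coming from $2$-isogenies not defined over $\mathbb{F}_p$ that must be added to obtain the spine; its endpoints are always two distinct floor vertices, and here it is treated as an arbitrary edge joining two distinct floor vertices. The diameter is the maximum graph distance between two vertices. -}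

module Defs where

open import Level using (0ℓ)
open import Algebra.Bundles using (CommutativeRing)
open import Algebra.Structures using (IsCommutativeRing)
open import Data.Nat as ℕ using (ℕ; suc)
import Data.Nat.Properties as ℕₚ
open import Data.Nat.Divisibility using (_∣_)
open import Data.Integer as ℤ using (ℤ)
open import Data.Rational as ℚ using (ℚ; 0ℚ; 1ℚ)
open import Data.Rational.Properties as ℚₚ using ()
open import Data.Rational.Solver using (module +-*-Solver)
open import Data.Fin using (Fin; toℕ)
open import Data.List using (List; []; _∷_)
open import Data.Product using (_×_; _,_; ∃-syntax)
open import Data.Sum using (_⊎_; inj₁; inj₂; swap)
open import Function using (_∘_)
open import Relation.Binary using (Rel; Symmetric; Irreflexive)
open import Relation.Binary.PropositionalEquality
open import Relation.Nullary using (¬_)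
open import Relation.Unary using (Pred; _∈_; _∉_; _⊆_; _≐_)

module ImaginaryQuadratic (p : ℕ) where

  -- (a , b) stands for a + b √-p
  K : Set
  K = ℚ × ℚ

  fromℚ : ℚ → K
  fromℚ q = q , 0ℚ

  fromℤ : ℤ → K
  fromℤ z = fromℚ (z ℚ./ 1)

  private
    pℚ : ℚ
    pℚ = (ℤ.+ p) ℚ./ 1

  infixl 6 _+_
  infixl 7 _*_
  infix  8 -_

  _+_ _*_ : K → K → K
  (a , b) + (c , d) = a ℚ.+ c , b ℚ.+ d
  (a , b) * (c , d) = a ℚ.* c ℚ.- pℚ ℚ.* (b ℚ.* d) , a ℚ.* d ℚ.+ b ℚ.* c

  -_ : K → K
  - (a , b) = ℚ.- a , ℚ.- b

  0# 1# : K
  0# = fromℚ 0ℚ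
  1# = fromℚ 1ℚ

  private
    *-comm : ∀ x y → x * y ≡ y * x
    *-comm (a , b) (c , d) = cong₂ _,_
      (solve 5 (λ a b c d q → a :* c :- q :* (b :* d) := c :* a :- q :* (d :* b)) refl a b c d pℚ)
      (solve 4 (λ a b c d → a :* d :+ b :* c := c :* b :+ d :* a) refl a b c d)
      where open +-*-Solver

    *-assoc : ∀ x y z → (x * y) * z ≡ x * (y * z)
    *-assoc (a , b) (c , d) (e , f) = cong₂ _,_
      (solve 7 (λ a b c d e f q →
          (a :* c :- q :* (b :* d)) :* e :- q :* ((a :* d :+ b :* c) :* f)
            := a :* (c :* e :- q :* (d :* f)) :- q :* (b :* (c :* f :+ d :* e)))
        refl a b c d e f pℚ)
      (solve 7 (λ a b c d e f q →
          (a :* c :- q :* (b :* d)) :* f :+ (a :* d :+ b :* c) :* e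
            := a :* (c :* f :+ d :* e) :+ b :* (c :* e :- q :* (d :* f)))
        refl a b c d e f pℚ)
      where open +-*-Solver

    *-identityˡ : ∀ x → 1# * x ≡ x
    *-identityˡ (a , b) = cong₂ _,_
      (solve 3 (λ a b q → con 1ℚ :* a :- q :* (con 0ℚ :* b) := a) refl a b pℚ)
      (solve 2 (λ a b → con 1ℚ :* b :+ con 0ℚ :* a := b) refl a b)
      where open +-*-Solver

    distribˡ : ∀ x y z → x * (y + z) ≡ x * y + x * z
    distribˡ (a , b) (c , d) (e , f) = cong₂ _,_
      (solve 7 (λ a b c d e f q →
          a :* (c :+ e) :- q :* (b :* (d :+ f))
            := (a :* c :- q :* (b :* d)) :+ (a :* e :- q :* (b :* f)))
        refl a b c d e f pℚ)
      (solve 6 (λ a b c d e f →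
          a :* (d :+ f) :+ b :* (c :+ e) := (a :* d :+ b :* c) :+ (a :* f :+ b :* e))
        refl a b c d e f)
      where open +-*-Solver

  isCommutativeRing : IsCommutativeRing _≡_ _+_ _*_ -_ 0# 1#
  isCommutativeRing = record
    { isRing = record
      { +-isAbelianGroup = record
        { isGroup = record
          { isMonoid = record
            { isSemigroup = record
              { isMagma = record { isEquivalence = isEquivalence ; ∙-cong = cong₂ _+_ }
              ; assoc = λ (a , b) (c , d) (e , f) →
                  cong₂ _,_ (ℚₚ.+-assoc a c e) (ℚₚ.+-assoc b d f)
              }
            ; identity =
                (λ (a , b) → cong₂ _,_ (ℚₚ.+-identityˡ a) (ℚₚ.+-identityˡ b))
              , (λ (a , b) → cong₂ _,_ (ℚₚ.+-identityʳ a) (ℚₚ.+-identityʳ b))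
            }
          ; inverse =
              (λ (a , b) → cong₂ _,_ (ℚₚ.+-inverseˡ a) (ℚₚ.+-inverseˡ b))
            , (λ (a , b) → cong₂ _,_ (ℚₚ.+-inverseʳ a) (ℚₚ.+-inverseʳ b))
          ; ⁻¹-cong = cong -_
          }
        ; comm = λ (a , b) (c , d) → cong₂ _,_ (ℚₚ.+-comm a c) (ℚₚ.+-comm b d)
        }
      ; *-cong = cong₂ _*_
      ; *-assoc = *-assoc
      ; *-identity = *-identityˡ , λ x → trans (*-comm x 1#) (*-identityˡ x)
      ; distrib = distribˡ , λ x y z →
          trans (*-comm (y + z) x)
            (trans (distribˡ x y z) (cong₂ _+_ (*-comm x y) (*-comm x z)))
      }
    ; *-comm = *-comm
    }

  commutativeRing : CommutativeRing 0ℓ 0ℓ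
  commutativeRing = record { isCommutativeRing = isCommutativeRing }

  -- For cs = c₀ ∷ … ∷ cₙ₋₁ ∷ [], the value c₀ + c₁ x + … + cₙ₋₁ xⁿ⁻¹ + xⁿ
  evalMonic : List ℤ → K → K
  evalMonic []       x = 1#
  evalMonic (c ∷ cs) x = fromℤ c + x * evalMonic cs x

  𝓞 : Pred K 0ℓ
  𝓞 x = ∃[ cs ] evalMonic cs x ≡ 0#

  record IsIdeal (I : Pred K 0ℓ) : Set where
    field
      integral : I ⊆ 𝓞
      0-closed : 0# ∈ I
      +-closed : ∀ {x y} → x ∈ I → y ∈ I → x + y ∈ I
      *-closed : ∀ {a x} → a ∈ 𝓞 → x ∈ I → a * x ∈ I

  record IsPrimeIdeal (P : Pred K 0ℓ) : Set where
    field
      isIdeal : IsIdeal P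
      proper  : 1# ∉ P
      prime   : ∀ {x y} → x ∈ 𝓞 → y ∈ 𝓞 → x * y ∈ P → x ∈ P ⊎ y ∈ P

  infixl 7 _·_
  data _·_ (I J : Pred K 0ℓ) : Pred K 0ℓ where
    product : ∀ {x y} → x ∈ I → y ∈ J → (I · J) (x * y)
    sum     : ∀ {x y} → (I · J) x → (I · J) y → (I · J) (x + y)

  power : Pred K 0ℓ → ℕ → Pred K 0ℓ
  power I 0       = 𝓞
  power I (suc n) = I · power I n

  scale : K → Pred K 0ℓ → Pred K 0ℓ
  scale a I y = ∃[ x ] x ∈ I × y ≡ a * x

  -- Two nonzero ideals of 𝓞 have the same class when they differ by a factor in K*.
  infix 4 _∼_
  _∼_ : Rel (Pred K 0ℓ) _
  I ∼ J = ∃[ a ] a ≢ 0# × I ≐ scale a J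

  -- The class of 𝓞 is the identity and [I]ⁿ = [Iⁿ], so n is the order of [I].
  record IsClassOrder (I : Pred K 0ℓ) (n : ℕ) : Set where
    field
      positive : 1 ℕ.≤ n
      trivial  : power I n ∼ 𝓞
      minimal  : ∀ {k} → 1 ℕ.≤ k → power I k ∼ 𝓞 → n ℕ.≤ k

record SimpleGraph (V : Set) : Set₁ where
  field
    Adj         : Rel V 0ℓ
    symmetric   : Symmetric Adj
    irreflexive : Irreflexive _≡_ Adj

open SimpleGraph public using (Adj)

fromEdges : {V : Set} → Rel V 0ℓ → SimpleGraph V
fromEdges E = record
  { Adj         = λ u v → u ≢ v × (E u v ⊎ E v u)
  ; symmetric   = λ (u≢v , e) → u≢v ∘ sym , swap e
  ; irreflexive = λ u≡v (u≢v , _) → u≢v u≡v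
  }

addEdge : {V : Set} → SimpleGraph V → (a b : V) → a ≢ b → SimpleGraph V
addEdge G a b a≢b = record
  { Adj         = λ u v → Adj G u v ⊎ ((u ≡ a × v ≡ b) ⊎ (u ≡ b × v ≡ a))
  ; symmetric   = λ where
      (inj₁ e)                  → inj₁ (SimpleGraph.symmetric G e)
      (inj₂ (inj₁ (u≡a , v≡b))) → inj₂ (inj₂ (v≡b , u≡a))
      (inj₂ (inj₂ (u≡b , v≡a))) → inj₂ (inj₁ (v≡a , u≡b))
  ; irreflexive = λ where
      u≡v (inj₁ e)                  → SimpleGraph.irreflexive G u≡v e
      u≡v (inj₂ (inj₁ (u≡a , v≡b))) → a≢b (trans (sym u≡a) (trans u≡v v≡b))
      u≡v (inj₂ (inj₂ (u≡b , v≡a))) → a≢b (trans (sym v≡a) (trans (sym u≡v) u≡b))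
  }

data Walk {V : Set} (G : SimpleGraph V) : V → V → ℕ → Set where
  nil  : ∀ {u} → Walk G u u 0
  cons : ∀ {u v w n} → Adj G u v → Walk G v w n → Walk G u w (suc n)

IsDistance : {V : Set} → SimpleGraph V → V → V → ℕ → Set
IsDistance G u v d = Walk G u v d × (∀ {k} → Walk G u v k → d ℕ.≤ k)

-- The first component makes every distance finite.
IsDiameter : {V : Set} → SimpleGraph V → ℕ → Set
IsDiameter G d =
    (∀ u v → ∃[ k ] IsDistance G u v k × k ℕ.≤ d)
  × (∃[ u ] ∃[ v ] IsDistance G u v d)

isDiameter-unique : {V : Set} (G : SimpleGraph V) {d e : ℕ} →
                    IsDiameter G d → IsDiameter G e → d ≡ e
isDiameter-unique G D E = ℕₚ.≤-antisym (bound D E) (bound E D)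
  where
  bound : ∀ {d e} → IsDiameter G d → IsDiameter G e → d ℕ.≤ e
  bound (_ , u , v , _ , min) (all , _) with all u v
  ... | k , (walk , _) , k≤e = ℕₚ.≤-trans (min walk) k≤e

-- fromEdges symmetrises these oriented edges and removes loops (for L ≥ 3 there are none).
data StackedEdge (L : ℕ) (u v : Fin (2 ℕ.* L)) : Set where
  vertical : ∀ i → i ℕ.< L →
             toℕ u ≡ 2 ℕ.* i → toℕ v ≡ 2 ℕ.* i ℕ.+ 1 → StackedEdge L u v
  surface  : ∀ i → i ℕ.+ 1 ℕ.< L →
             toℕ u ≡ 2 ℕ.* i ℕ.+ 1 → toℕ v ≡ 2 ℕ.* i ℕ.+ 3 → StackedEdge L u v
  closing  : toℕ u ≡ 2 ℕ.* L ℕ.∸ 1 → toℕ v ≡ 1 → StackedEdge L u v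

stacked : (L : ℕ) → SimpleGraph (Fin (2 ℕ.* L))
stacked L = fromEdges (StackedEdge L)

Floor : {n : ℕ} → Fin n → Set
Floor v = 2 ∣ toℕ v

{-# OPTIONS --safe #-}

-- For L = 2m + 1 the component is a cycle of surface vertices with one pendant
-- floor vertex at each, of diameter m + 2.  As L is odd, exactly one of the two
-- arcs between the feet of the new edge has even length; let c be its midpoint.
-- Both ends of the new edge are equally far from the floor vertex at c, so the
-- distance from that vertex in the component still changes by at most 1 along
-- every edge of the enlarged graph, and an antipodal floor vertex remains at
-- distance m + 2.
module Submission where

open import Defs
open import Level using (0ℓ)
open import Data.Nat
open import Data.Nat.Properties
open import Data.Nat.Induction using (<-rec)
open import Data.Nat.DivMod using (m≡m%n+[m/n]*n)
open import Data.Nat.Divisibility using (divides)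
open import Data.Nat.Primality using (Prime)
open import Data.Nat.Tactic.RingSolver using (solve-∀)
open import Data.Integer using (+_)
open import Data.Fin using (Fin; toℕ; fromℕ<)
open import Data.Fin.Properties using (toℕ-injective; toℕ<n; toℕ-fromℕ<; any?) renaming (_≟_ to _≟ᶠ_)
open import Data.Product using (_×_; _,_; ∃-syntax; proj₁; proj₂; swap)
open import Data.Sum using (_⊎_; inj₁; inj₂; [_,_])
open import Function using (_∘_)
open import Relation.Nullary using (Dec; yes; no; ¬?)
open import Relation.Nullary.Decidable using (map′; _×-dec_; _⊎-dec_)
open import Relation.Unary using (Pred; _∈_)
import Relation.Unary as U
open import Relation.Binary using (Decidable)
open import Relation.Binary.PropositionalEquality using (_≡_; _≢_; refl; sym; trans; cong; cong₂; subst; subst₂)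

-- Preliminaries: least witnesses and parity.

-- `IsDistance` demands a shortest walk; this extracts its length from any walk, once existence of
-- walks of a given length is decidable.
least : ∀ {P : ℕ → Set} → U.Decidable P → ∀ n → P n →
        ∃[ k ] (k ≤ n × P k × (∀ {j} → P j → k ≤ j))
least {P} P? = <-rec _ search
  where
  search : ∀ n → (∀ {m} → m < n → P m → ∃[ k ] (k ≤ m × P k × (∀ {j} → P j → k ≤ j))) →
           P n → ∃[ k ] (k ≤ n × P k × (∀ {j} → P j → k ≤ j))
  search n rec pn with anyUpTo? P? n
  ... | yes (m , m<n , pm) = let (k , k≤m , r) = rec m<n pm in k , ≤-trans k≤m (<⇒≤ m<n) , r
  ... | no none = n , ≤-refl , pn , λ {j} pj → ≮⇒≥ (λ j<n → none (j , j<n , pj))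

halve : ∀ n → ∃[ i ] (n ≡ 2 * i ⊎ n ≡ 2 * i + 1)
halve zero = 0 , inj₁ refl
halve (suc n) with halve n
... | i , inj₁ refl = i , inj₂ (+-comm 1 (2 * i))
... | i , inj₂ refl = suc i , inj₁ (lemma i)
  where
  lemma : ∀ i → suc (2 * i + 1) ≡ 2 * suc i
  lemma = solve-∀

split : ∀ {i j} → i ≤ j → ∃[ k ] j ≡ i + k
split {i} {j} i≤j = j ∸ i , sym (m+[n∸m]≡n i≤j)

2*-cancel-< : ∀ {i L} → 2 * i < 2 * L → i < L
2*-cancel-< {i} {L} = *-cancelˡ-< 2 i L

-- Walks and diameters in general graphs.

module _ {V : Set} {G : SimpleGraph V} where

  infixr 5 _++_
  _++_ : ∀ {u v w j k} → Walk G u v j → Walk G v w k → Walk G u w (j + k)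
  nil      ++ q = q
  cons e p ++ q = cons e (p ++ q)

  reverse : ∀ {u v k} → Walk G u v k → Walk G v u k
  reverse nil = nil
  reverse {k = suc k} (cons e p) =
    subst (Walk G _ _) (+-comm k 1) (reverse p ++ cons (SimpleGraph.symmetric G e) nil)

  -- Source of every lower bound on distances: a potential that rises by at most 1 per edge forces
  -- long walks between vertices of very different values.
  lipschitz : (F : V → ℕ) → (∀ {u v} → Adj G u v → F v ≤ suc (F u)) →
              ∀ {u v k} → Walk G u v k → F v ≤ k + F u
  lipschitz F lip nil = ≤-refl
  lipschitz F lip {u} {k = suc k} (cons {v = v} e p) = begin
    F _           ≤⟨ lipschitz F lip p ⟩
    k + F v       ≤⟨ +-monoʳ-≤ k (lip e) ⟩
    k + suc (F u) ≡⟨ +-suc k (F u) ⟩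
    suc k + F u   ∎
    where open ≤-Reasoning

walk-mono : ∀ {V : Set} {G H : SimpleGraph V} → (∀ {u v} → Adj G u v → Adj H u v) →
            ∀ {u v k} → Walk G u v k → Walk H u v k
walk-mono G⊆H nil        = nil
walk-mono G⊆H (cons e p) = cons (G⊆H e) (walk-mono G⊆H p)

module _ {n} (G : SimpleGraph (Fin n)) (adj? : Decidable (Adj G)) where

  walk? : ∀ u v k → Dec (Walk G u v k)
  walk? u v zero = map′ (λ { refl → nil }) (λ { nil → refl }) (u ≟ᶠ v)
  walk? u v (suc k) = map′ (λ (w , e , p) → cons e p) (λ { (cons e p) → _ , e , p })
    (any? (λ w → adj? u w ×-dec walk? w v k))

  -- The walks in `short` may be longer than necessary: `least` shortens them, and on the pair `x`,
  -- `y` the two bounds meet at `d`.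
  isDiameter : ∀ {d} → (∀ u v → ∃[ k ] (k ≤ d × Walk G u v k)) →
               ∀ x y → (∀ {k} → Walk G x y k → d ≤ k) → IsDiameter G d
  isDiameter {d} short x y far = bounded , x , y , attained
    where
    bounded : ∀ u v → ∃[ k ] (IsDistance G u v k × k ≤ d)
    bounded u v =
      let (k , k≤d , p) = short u v
          (l , l≤k , q , minimal) = least (walk? u v) k p
      in l , (q , minimal) , ≤-trans l≤k k≤d
    attained : IsDistance G x y d
    attained with short x y
    ... | k , k≤d , p with refl ← ≤-antisym k≤d (far p) = p , far

-- Decidability of adjacency.

stackedEdge? : ∀ L → Decidable (StackedEdge L)
stackedEdge? L u v = map′
  [ (λ (i , i<L , eu , ev) → vertical i i<L eu ev)
  , [ (λ (i , _ , lt , eu , ev) → surface i lt eu ev) , (λ (eu , ev) → closing eu ev) ] ]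
  (λ { (vertical i i<L eu ev) → inj₁ (i , i<L , eu , ev)
     -- The bounded search for `i` asks for `i < L`, which follows from `i + 1 < L`.
     ; (surface i lt eu ev)   → inj₂ (inj₁ (i , ≤-<-trans (m≤m+n i 1) lt , lt , eu , ev))
     ; (closing eu ev)        → inj₂ (inj₂ (eu , ev)) })
  (anyUpTo? (λ i → (toℕ u ≟ 2 * i) ×-dec (toℕ v ≟ 2 * i + 1)) L
   ⊎-dec (anyUpTo? (λ i → (i + 1 <? L) ×-dec ((toℕ u ≟ 2 * i + 1) ×-dec (toℕ v ≟ 2 * i + 3))) L
   ⊎-dec ((toℕ u ≟ 2 * L ∸ 1) ×-dec (toℕ v ≟ 1))))

stackedAdj? : ∀ L → Decidable (Adj (stacked L))
stackedAdj? L u v = ¬? (u ≟ᶠ v) ×-dec (stackedEdge? L u v ⊎-dec stackedEdge? L v u)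

addEdgeAdj? : ∀ {n} (G : SimpleGraph (Fin n)) a b (a≢b : a ≢ b) →
              Decidable (Adj G) → Decidable (Adj (addEdge G a b a≢b))
addEdgeAdj? G a b a≢b adj? u v =
  adj? u v ⊎-dec (((u ≟ᶠ a) ×-dec (v ≟ᶠ b)) ⊎-dec ((u ≟ᶠ b) ×-dec (v ≟ᶠ a)))

-- Distance on a cycle.

_≈₁_ : ℕ → ℕ → Set
a ≈₁ b = a ≤ suc b × b ≤ suc a

∣m+n-m∣≡n : ∀ m n → ∣ m + n - m ∣ ≡ n
∣m+n-m∣≡n m n = trans (∣-∣-comm (m + n) m) (∣m-m+n∣≡n m n)

-- fold L ∣ i - j ∣ is the distance of i and j on the cycle of length L.
fold : ℕ → ℕ → ℕ
fold L k = k ⊓ (L ∸ k)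

-- `k` and `r` are complementary arcs of the cycle; both sides equal `k ⊓ r`.
fold-sym : ∀ k r → fold (k + r) k ≡ fold (k + r) r
fold-sym k r = trans (cong (k ⊓_) (m+n∸m≡n k r))
  (trans (⊓-comm k r) (cong (r ⊓_) (sym (m+n∸n≡m k r))))

-- Each argument of the minimum moves by at most 1; past `L`, truncated subtraction keeps `L ∸ k` at
-- 0.
fold-suc : ∀ L k → fold L (suc k) ≈₁ fold L k
fold-suc L k =
    ⊓-mono-≤ ≤-refl (≤-trans (∸-monoʳ-≤ L (n≤1+n k)) (n≤1+n _))
  , ⊓-mono-≤ (≤-trans (n≤1+n k) (n≤1+n _))
      (subst (λ z → L ∸ k ≤ suc z) (pred[m∸n]≡m∸[1+n] L k) (m≤n+m∸n (L ∸ k) 1))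

∣suc-∣ : ∀ i c → ∣ suc i - c ∣ ≡ suc ∣ i - c ∣ ⊎ ∣ i - c ∣ ≡ suc ∣ suc i - c ∣
∣suc-∣ zero    zero    = inj₁ refl
∣suc-∣ (suc i) zero    = inj₁ refl
∣suc-∣ zero    (suc c) = inj₂ refl
∣suc-∣ (suc i) (suc c) = ∣suc-∣ i c

fold-step : ∀ L c i → fold L ∣ suc i - c ∣ ≈₁ fold L ∣ i - c ∣
fold-step L c i with ∣suc-∣ i c
... | inj₁ eq rewrite eq = fold-suc L _
... | inj₂ eq rewrite eq = swap (fold-suc L _)

-- This is the step across the closing edge. With `L = c + r + 1` the last position is `r` away from
-- `c`, and `r + 1` is the arc complementary to `c`, so the claim is `fold-suc` at `r`.
fold-wrap : ∀ L c → c < L → fold L ∣ pred L - c ∣ ≈₁ fold L ∣ 0 - c ∣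
fold-wrap (suc l) c c<L with split (s≤s⁻¹ c<L)
... | r , refl = subst₂ (λ x y → fold (suc (c + r)) x ≈₁ y) (sym (∣m+n-m∣≡n c r)) eq
                   (swap (fold-suc (suc (c + r)) r))
  where
  eq : fold (suc (c + r)) (suc r) ≡ fold (suc (c + r)) c
  eq = subst (λ L → fold L (suc r) ≡ fold L c) (+-suc c r) (sym (fold-sym c (suc r)))

-- Midpoints and antipodes on a cycle of odd length.

2h+1<2m+1⇒h≤m : ∀ h m → 2 * h + 1 < 2 * m + 1 → h ≤ m
2h+1<2m+1⇒h≤m h m lt = <⇒≤ (2*-cancel-< (+-cancelʳ-< 1 (2 * h) (2 * m) lt))

-- The arc from i to i + k has odd length, so the complementary arc has even
-- length 2r; its midpoint is i - r or i + k + r, according to where it meets 0.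
midpoint-around : ∀ r k i → i + k < r + (r + k) →
  ∃[ c ] (c < r + (r + k) × fold (r + (r + k)) ∣ i - c ∣ ≡ fold (r + (r + k)) ∣ i + k - c ∣)
midpoint-around r k i j<L with i <? r
... | yes i<r = i + k + r , bound , eq
  where
  bound : i + k + r < r + (r + k)
  bound = subst₂ _<_ (sym (+-assoc i k r)) (cong (λ x → r + x) (+-comm k r)) (+-monoˡ-< (k + r) i<r)
  -- One end lies `r` from the midpoint, the other `r + k` along the arc that avoids 0; these two
  -- arcs make up the whole cycle, so they fold to the same value.
  eq : fold (r + (r + k)) ∣ i - i + k + r ∣ ≡ fold (r + (r + k)) ∣ i + k - i + k + r ∣
  eq rewrite ∣m-m+n∣≡n (i + k) r | +-assoc i k r | ∣m-m+n∣≡n i (k + r) | +-comm k r =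
    sym (fold-sym r (r + k))
... | no i≮r with split (≮⇒≥ i≮r)
... | c , refl = c , ≤-<-trans (≤-trans (m≤n+m c r) (m≤m+n (r + c) k)) j<L , eq
  where
  eq : fold (r + (r + k)) ∣ r + c - c ∣ ≡ fold (r + (r + k)) ∣ r + c + k - c ∣
  eq rewrite +-comm r c | +-assoc c r k | ∣m+n-m∣≡n c r | ∣m+n-m∣≡n c (r + k) =
    fold-sym r (r + k)

complementary-arc : ∀ h r → 2 * (h + r) + 1 ≡ r + (r + (2 * h + 1))
complementary-arc = solve-∀

midpoint : ∀ m i j → i ≤ j → j < 2 * m + 1 →
           ∃[ c ] (c < 2 * m + 1 × fold (2 * m + 1) ∣ i - c ∣ ≡ fold (2 * m + 1) ∣ j - c ∣)
midpoint m i j i≤j j<L with split i≤j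
... | k , refl with halve k
-- The direct arc is even, and its midpoint is `h` from both ends even before folding.
... | h , inj₁ refl = i + h , ≤-<-trans (+-monoʳ-≤ i (m≤m+n h _)) j<L , cong (fold (2 * m + 1)) eq
  where
  lemma : ∀ i h → i + 2 * h ≡ i + h + h
  lemma = solve-∀
  eq : ∣ i - i + h ∣ ≡ ∣ i + 2 * h - i + h ∣
  eq rewrite lemma i h = trans (∣m-m+n∣≡n i h) (sym (∣m+n-m∣≡n (i + h) h))
-- The direct arc has length `2 * h + 1`; writing `m = h + r` leaves `2 * r` for the other arc.
... | h , inj₂ refl with split (2h+1<2m+1⇒h≤m h m (≤-<-trans (m≤n+m (2 * h + 1) i) j<L))
... | r , refl rewrite complementary-arc h r = midpoint-around r (2 * h + 1) i j<L

odd-arcs : ∀ m → 2 * m + 1 ≡ m + (m + 1)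
odd-arcs = solve-∀

fold-half : ∀ m → fold (m + (m + 1)) m ≡ m
fold-half m rewrite m+n∸m≡n m (m + 1) = m≤n⇒m⊓n≡m (m≤m+n m 1)

-- Going up by `m` from `c` or down by `m + 1` reaches the same point of the cycle; whichever stays
-- within the labels is taken, and `fold` selects the shorter arc `m`.
antipode : ∀ m c → c < 2 * m + 1 → ∃[ x ] (x < 2 * m + 1 × fold (2 * m + 1) ∣ x - c ∣ ≡ m)
antipode m c c<L rewrite odd-arcs m with c <? m + 1
... | yes c<m+1 = m + c , +-monoʳ-< m c<m+1 , eq
  where
  eq : fold (m + (m + 1)) ∣ m + c - c ∣ ≡ m
  eq rewrite +-comm m c | ∣m+n-m∣≡n c m = fold-half m
... | no c≮m+1 with split (≮⇒≥ c≮m+1)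
... | x , refl = x , ≤-<-trans (m≤n+m x (m + 1)) c<L , eq
  where
  eq : fold (m + (m + 1)) ∣ x - m + 1 + x ∣ ≡ m
  eq rewrite +-comm (m + 1) x | ∣m-m+n∣≡n x (m + 1) = trans (sym (fold-sym m (m + 1))) (fold-half m)

-- Heights of labels over a base floor vertex.

-- The distance of two floor vertices whose surface neighbours are k apart.
floorHeight : ℕ → ℕ
floorHeight zero    = 0
floorHeight (suc k) = 2 + suc k

floorHeight-positive : ∀ {k} → 1 ≤ k → floorHeight k ≡ 2 + k
floorHeight-positive (s≤s _) = refl

-- The distance of the vertex labelled n from a fixed floor vertex at position c,
-- when d i is the cyclic distance of i and c; each recursive call shifts d by
-- one position, that is by two labels.
height : (ℕ → ℕ) → ℕ → ℕ
height d 0             = floorHeight (d 0)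
height d 1             = suc (d 0)
height d (suc (suc n)) = height (d ∘ suc) n

height-floor : ∀ d i → height d (2 * i) ≡ floorHeight (d i)
height-floor d zero = refl
height-floor d (suc i) rewrite +-suc i (i + 0) = height-floor (d ∘ suc) i

height-surface : ∀ d i → height d (2 * i + 1) ≡ suc (d i)
height-surface d zero = refl
height-surface d (suc i) rewrite +-suc i (i + 0) = height-surface (d ∘ suc) i

-- A floor vertex is one edge further than its surface neighbour, except the base vertex itself,
-- which is one edge nearer.
height-vertical : ∀ k → floorHeight k ≈₁ suc k
height-vertical zero = z≤n , s≤s z≤n
height-vertical (suc k) = ≤-refl , s≤s (m≤n+m (suc k) 2)

-- Upper bound: short walks in the component.

module _ (m : ℕ) (1≤m : 1 ≤ m) where

  private
    L = 2 * m + 1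
    V = Fin (2 * L)
    T = stacked L

  floorAt surfaceAt : ∀ i → i < L → V
  floorAt   i i<L = fromℕ< (*-monoʳ-< 2 i<L)
  surfaceAt i i<L = fromℕ< (subst (_≤ 2 * L) (lemma i) (*-monoʳ-≤ 2 i<L))
    where
    lemma : ∀ i → 2 * suc i ≡ suc (2 * i + 1)
    lemma = solve-∀

  toℕ-floorAt : ∀ i (i<L : i < L) → toℕ (floorAt i i<L) ≡ 2 * i
  toℕ-floorAt i i<L = toℕ-fromℕ< _

  toℕ-surfaceAt : ∀ i (i<L : i < L) → toℕ (surfaceAt i i<L) ≡ 2 * i + 1
  toℕ-surfaceAt i i<L = toℕ-fromℕ< _

  next-surface : ∀ i → 2 * i + 3 ≡ 2 * suc i + 1
  next-surface = solve-∀

  surface-edge : ∀ {u v : V} i → suc i < L → toℕ u ≡ 2 * i + 1 → toℕ v ≡ 2 * suc i + 1 → Adj T u v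
  surface-edge {u} {v} i lt eu ev =
      (λ { refl → 1+n≢n (*-cancelˡ-≡ (suc i) i 2 (+-cancelʳ-≡ 1 _ _ (trans (sym ev) eu))) })
    , inj₁ (surface i (subst (_< L) (+-comm 1 i) lt) eu (trans ev (sym (next-surface i))))

  last-label : 2 * (2 * m) + 1 ≡ 2 * L ∸ 1
  last-label = cong (_∸ 1) (lemma m)
    where
    lemma : ∀ m → suc (2 * (2 * m) + 1) ≡ 2 * (2 * m + 1)
    lemma = solve-∀

  closing-edge : ∀ {u v : V} → toℕ u ≡ 2 * (2 * m) + 1 → toℕ v ≡ 1 → Adj T u v
  closing-edge eu ev = (λ { refl → absurd (trans (sym eu) ev) })
                     , inj₁ (closing (trans eu last-label) ev)
    where
    -- `fromEdges` discards loops, and the closing edge would be a loop for `m = 0`.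
    absurd : 2 * (2 * m) + 1 ≢ 1
    absurd eq = >⇒≢ 1≤m (*-cancelˡ-≡ m 0 2 (*-cancelˡ-≡ (2 * m) 0 2 (+-cancelʳ-≡ 1 _ 0 eq)))

  vertical-edge : ∀ {u v : V} i → i < L → toℕ u ≡ 2 * i → toℕ v ≡ 2 * i + 1 → Adj T u v
  vertical-edge i i<L eu ev =
      (λ { refl → 1+n≢n (trans (+-comm 1 _) (trans (sym ev) eu)) }) , inj₁ (vertical i i<L eu ev)

  clockwise : ∀ k {u v : V} i → toℕ u ≡ 2 * i + 1 → toℕ v ≡ 2 * (i + k) + 1 → i + k < L → Walk T u v k
  clockwise zero {u} {v} i eu ev lt
    with refl ← toℕ-injective {i = u} {j = v}
                  (trans eu (trans (cong (λ j → 2 * j + 1) (sym (+-identityʳ i))) (sym ev))) = nil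
  clockwise (suc k) i eu ev lt rewrite +-suc i k =
    cons (surface-edge i i+1<L eu (toℕ-surfaceAt (suc i) i+1<L))
         (clockwise k (suc i) (toℕ-surfaceAt (suc i) i+1<L) ev lt)
    where
    i+1<L : suc i < L
    i+1<L = ≤-<-trans (s≤s (m≤m+n i k)) lt

  -- The two arcs between the positions have total length `2 * m + 1`, so one of them has length at
  -- most `m`.
  surface-walk : ∀ {u v : V} i j → i ≤ j → j < L → toℕ u ≡ 2 * i + 1 → toℕ v ≡ 2 * j + 1 →
                 ∃[ k ] (k ≤ m × Walk T u v k)
  surface-walk i j i≤j j<L eu ev with split i≤j
  ... | k , refl with k ≤? m
  ... | yes k≤m = k , k≤m , clockwise k i eu ev j<L
  ... | no k≰m with split (s≤s⁻¹ (subst (i + k <_) (+-comm (2 * m) 1) j<L))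
  -- The walk goes down from `i` to 0, crosses the closing edge to position `2 * m`, and goes down
  -- `r` more to `i + k`; its length is `2 * m + 1` less `k`.
  ... | r , eq = i + suc r , short ,
        reverse (clockwise i 0 (toℕ-surfaceAt 0 0<L) eu i<L)
        ++ cons (SimpleGraph.symmetric T (closing-edge (toℕ-surfaceAt (2 * m) 2m<L) (toℕ-surfaceAt 0 0<L)))
                (reverse (clockwise r (i + k) ev
                  (trans (toℕ-surfaceAt (2 * m) 2m<L) (cong (λ x → 2 * x + 1) eq))
                  (subst (_< L) eq 2m<L)))
    where
    2m<L : 2 * m < L
    2m<L = m<m+n (2 * m) z<s
    0<L : 0 < L
    0<L = ≤-<-trans z≤n 2m<L
    short : i + suc r ≤ m
    short = +-cancelʳ-≤ m (i + suc r) m (begin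
      i + suc r + m ≡⟨ lemma i r m ⟩
      i + suc m + r ≤⟨ +-monoˡ-≤ r (+-monoʳ-≤ i (≰⇒> k≰m)) ⟩
      i + k + r     ≡⟨ sym eq ⟩
      2 * m         ≡⟨ cong (λ x → m + x) (+-identityʳ m) ⟩
      m + m         ∎)
      where
      open ≤-Reasoning
      lemma : ∀ i r m → i + suc r + m ≡ i + suc m + r
      lemma = solve-∀
    i<L : i < L
    i<L = ≤-<-trans i≤j j<L

  foot : ∀ v → ∃[ i ] ∃[ s ] ∃[ k ] (i < L × toℕ s ≡ 2 * i + 1 × k ≤ 1 × Walk T v s k)
  foot v with halve (toℕ v)
  ... | i , inj₂ ev = i , v , 0 , 2*-cancel-< (≤-<-trans (m≤m+n (2 * i) 1) (subst (_< 2 * L) ev (toℕ<n v))) , ev , z≤n , nil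
  ... | i , inj₁ ev = i , surfaceAt i i<L , 1 , i<L , toℕ-surfaceAt i i<L , ≤-refl
                    , cons (vertical-edge i i<L ev (toℕ-surfaceAt i i<L)) nil
    where
    i<L : i < L
    i<L = 2*-cancel-< (subst (_< 2 * L) ev (toℕ<n v))

  -- At most one vertical edge at each end, and at most `m` edges along the cycle between the feet.
  short-walk : ∀ u v → ∃[ k ] (k ≤ 2 + m × Walk T u v k)
  short-walk u v with foot u | foot v
  ... | i , s , k , i<L , es , k≤1 , p | j , t , l , j<L , et , l≤1 , q =
    let (n , n≤m , r) = between (≤-total i j)
    in k + (n + l) , ≤-trans (+-mono-≤ k≤1 (+-mono-≤ n≤m l≤1)) (s≤s (≤-reflexive (+-comm m 1)))
     , p ++ (r ++ reverse q)
    where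
    between : i ≤ j ⊎ j ≤ i → ∃[ n ] (n ≤ m × Walk T s t n)
    between (inj₁ i≤j) = surface-walk i j i≤j j<L es et
    between (inj₂ j≤i) = let (n , n≤m , r) = surface-walk j i j≤i i<L et es in n , n≤m , reverse r

  -- Lower bound: the potential of the floor vertex at `c`.

  module _ (c : ℕ) (c<L : c < L) where

    distanceFrom : V → ℕ
    distanceFrom v = height (λ i → fold L ∣ i - c ∣) (toℕ v)

    at-floor : ∀ {v : V} i → toℕ v ≡ 2 * i → distanceFrom v ≡ floorHeight (fold L ∣ i - c ∣)
    at-floor i ev = trans (cong (height _) ev) (height-floor _ i)

    at-surface : ∀ {v : V} i → toℕ v ≡ 2 * i + 1 → distanceFrom v ≡ suc (fold L ∣ i - c ∣)
    at-surface i ev = trans (cong (height _) ev) (height-surface _ i)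

    -- Two-sided because `StackedEdge` is oriented while a walk may traverse an edge either way.
    edge-near : ∀ {u v} → StackedEdge L u v → distanceFrom u ≈₁ distanceFrom v
    edge-near {u} {v} (vertical i _ eu ev)
      rewrite at-floor {u} i eu | at-surface {v} i ev = height-vertical _
    edge-near {u} {v} (surface i _ eu ev)
      rewrite at-surface {u} i eu | at-surface {v} (suc i) (trans ev (next-surface i)) =
      let (p , q) = fold-step L c i in s≤s q , s≤s p
    edge-near {u} {v} (closing eu ev)
      rewrite at-surface {u} (2 * m) (trans eu (sym last-label)) | at-surface {v} 0 ev =
      let (p , q) = subst (λ l → fold L ∣ l - c ∣ ≈₁ fold L ∣ 0 - c ∣) (cong pred (+-comm (2 * m) 1))
                          (fold-wrap L c c<L)
      in s≤s p , s≤s q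

    stacked-lipschitz : ∀ {u v} → Adj T u v → distanceFrom v ≤ suc (distanceFrom u)
    stacked-lipschitz (_ , inj₁ e) = proj₂ (edge-near e)
    stacked-lipschitz (_ , inj₂ e) = proj₁ (edge-near e)

    far-pair : ∃[ u ] ∃[ v ] (distanceFrom u ≡ 0 × distanceFrom v ≡ 2 + m)
    far-pair =
      let (x , x<L , eq) = antipode m c c<L
      in floorAt c c<L , floorAt x x<L
       , trans (at-floor c (toℕ-floorAt c c<L)) (cong (floorHeight ∘ fold L) (∣n-n∣≡0 c))
       -- As `m` is positive, the antipode differs from `c` and `floorHeight` takes its second
       -- branch.
       , trans (at-floor x (toℕ-floorAt x x<L)) (trans (cong floorHeight eq) (floorHeight-positive 1≤m))

  -- The new edge and the equality of diameters.

  position< : ∀ (v : V) i → toℕ v ≡ i * 2 → i < L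
  position< v i ev = 2*-cancel-< (subst (_< 2 * L) (trans ev (*-comm i 2)) (toℕ<n v))

  balanced-position : ∀ (a b : V) i j → toℕ a ≡ i * 2 → toℕ b ≡ j * 2 →
                      ∃[ c ] (c < L × fold L ∣ i - c ∣ ≡ fold L ∣ j - c ∣)
  balanced-position a b i j ea eb with ≤-total i j
  ... | inj₁ i≤j = midpoint m i j i≤j (position< b j eb)
  ... | inj₂ j≤i = let (c , c<L , eq) = midpoint m j i j≤i (position< a i ea) in c , c<L , sym eq

  diameters : (a b : V) → Floor a → Floor b → (a≢b : a ≢ b) →
              ∃[ d ] (IsDiameter T d × IsDiameter (addEdge T a b a≢b) d)
  diameters a b (divides i ea) (divides j eb) a≢b
    with balanced-position a b i j ea eb
  ... | c , c<L , eq = 2 + m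
    -- Every walk of `T` is one of `T+E`. Hence the lower bound `far`, proved in `T+E`, passes down
    -- to `T`, and the short walks of `T` serve in `T+E`.
    , isDiameter T (stackedAdj? L) short-walk x y (λ p → far (walk-mono inj₁ p))
    , isDiameter T+E (addEdgeAdj? T a b a≢b (stackedAdj? L))
        (λ u v → let (k , k≤d , p) = short-walk u v in k , k≤d , walk-mono inj₁ p) x y far
    where
    T+E = addEdge T a b a≢b
    F = distanceFrom c c<L
    x = proj₁ (far-pair c c<L)
    y = proj₁ (proj₂ (far-pair c c<L))
    Fa≡Fb : F a ≡ F b
    Fa≡Fb = trans (at-floor c c<L i (trans ea (*-comm i 2)))
              (trans (cong floorHeight eq) (sym (at-floor c c<L j (trans eb (*-comm j 2)))))
    lip : ∀ {u v} → Adj T+E u v → F v ≤ suc (F u)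
    lip (inj₁ e)                    = stacked-lipschitz c c<L e
    -- The choice of `c` makes the potential constant along the new edge.
    lip (inj₂ (inj₁ (refl , refl))) = ≤-trans (≤-reflexive (sym Fa≡Fb)) (n≤1+n _)
    lip (inj₂ (inj₂ (refl , refl))) = ≤-trans (≤-reflexive Fa≡Fb) (n≤1+n _)
    far : ∀ {k} → Walk T+E x y k → 2 + m ≤ k
    far {k} p = let (Fx , Fy) = proj₂ (proj₂ (far-pair c c<L)) in begin
      2 + m   ≡⟨ sym Fy ⟩
      F y     ≤⟨ lipschitz F lip p ⟩
      k + F x ≡⟨ cong (λ z → k + z) Fx ⟩
      k + 0   ≡⟨ +-identityʳ k ⟩
      k       ∎
      where open ≤-Reasoning

theorem35 : (p : ℕ) → Prime p → (p % 120 ≡ 71 ⊎ p % 120 ≡ 119) →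
    (𝔭 : Pred (ImaginaryQuadratic.K p) 0ℓ) →
    ImaginaryQuadratic.IsPrimeIdeal p 𝔭 → ImaginaryQuadratic.fromℤ p (+ 2) ∈ 𝔭 →
    (L : ℕ) → ImaginaryQuadratic.IsClassOrder p 𝔭 L → L % 2 ≡ 1 → 3 ≤ L →
    (a b : Fin (2 * L)) → Floor a → Floor b → (a≢b : a ≢ b) →
    ∃[ d ] (IsDiameter (stacked L) d × IsDiameter (addEdge (stacked L) a b a≢b) d)
theorem35 p _ _ 𝔭 _ _ L _ odd 3≤L = for-half (L / 2) L≡ 3≤L
  where
  L≡ : L ≡ 2 * (L / 2) + 1
  L≡ = trans (m≡m%n+[m/n]*n L 2)
         (trans (cong₂ _+_ odd (*-comm (L / 2) 2)) (+-comm 1 (2 * (L / 2))))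
  -- In `L≡` the variable `L` occurs on both sides, which blocks matching on `refl`; generalising
  -- `L / 2` to `m` lets `2 * m + 1` replace `L` in the types of `a` and `b`.
  for-half : ∀ {L} m → L ≡ 2 * m + 1 → 3 ≤ L → (a b : Fin (2 * L)) → Floor a → Floor b → (a≢b : a ≢ b) →
             ∃[ d ] (IsDiameter (stacked L) d × IsDiameter (addEdge (stacked L) a b a≢b) d)
  -- `m = 0` would give `L = 1`, against `3 ≤ L`.
  for-half zero    refl (s≤s ())
  for-half (suc m) refl _ = diameters (suc m) (s≤s z≤n)
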